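{- Each of ISPNEW, ISOP and ISUP is equivalent to the maximum weight independent set problem (MWISP): every instance of one can be formulated as an instance of the other on the same graph so that an optimal solution of the new instance is an optimal solution of the original instance.
   Context: Let $G=(V,E)$ be a graph with vertex weights $c_i\in\mathbb{R}$ and edge weights $q^0_{ij},q^1_{ij}\in\mathbb{R}$. An independent set is a set $P\subseteq V$ containing no edge. For $P\subseteq V$ let $E_0(P)$ be the edges with no endpoint in $P$ and $E_1(P)$ the edges with exactly one endpoint in $P$. ISPNEW is to find an independent set $P$ maximizing $\sum_{i\in P}c_i+\sum_{(i,j)\in E_0(P)}q^0_{ij}+\sum_{(i,j)\in E_1(P)}q^1_{ij}$. ISOP is the special case $q^1\equiv0$; ISUP is the special case $q^0\equiv0$. MWISP: given real vertex weights $w_i$, find an independent set $P$ maximizing $\sum_{i\in P}w_i$. -}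

module Defs where

open import Data.Bool using (_∧_; _xor_; not)
open import Data.Fin using (Fin; zero; suc)
import Data.Fin as Fin
open import Data.Fin.Subset using (Subset; inside; outside; _∈_)
open import Data.Nat using (ℕ)
import Data.Nat as ℕ
import Data.Nat.Properties as ℕ
open import Data.Product using (_×_; _,_; proj₁; proj₂; ∃)
open import Data.Rational as ℚ using (ℚ; 0ℚ; ½)
import Data.Rational.Properties as ℚ
open import Data.Rational.Solver using (module +-*-Solver)
open import Data.Vec using ([]; _∷_; lookup; tabulate)
open import Function.Definitions using (Injective)
open import Relation.Binary.PropositionalEquality
  using (_≡_; refl; sym; trans; cong)
open import Relation.Nullary using (¬_)

------------------------------------------------------------------------
-- Real numbers

IsCauchy : (ℕ → ℚ) → Set
IsCauchy x = ∀ ε → 0ℚ ℚ.< ε →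
  ∃ λ N → ∀ m n → N ℕ.≤ m → N ℕ.≤ n → ℚ.∣ x m ℚ.- x n ∣ ℚ.< ε

-- Cauchy sequences of rationals, not quotiented: two sequences represent
-- the same real when each is ≤ the other.
record ℝ : Set where
  constructor mkℝ
  field
    seq    : ℕ → ℚ
    cauchy : IsCauchy seq

open ℝ public

infix  4 _≤_
infixl 6 _+_

_≤_ : ℝ → ℝ → Set
x ≤ y = ∀ ε → 0ℚ ℚ.< ε →
  ∃ λ N → ∀ n → N ℕ.≤ n → seq x n ℚ.< seq y n ℚ.+ ε

0ℝ : ℝ
0ℝ = mkℝ (λ _ → 0ℚ) (λ ε 0<ε → 0 , λ _ _ _ _ → 0<ε)

private
  halves : ∀ ε → ½ ℚ.* ε ℚ.+ ½ ℚ.* ε ≡ ε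
  halves ε = trans (sym (ℚ.*-distribʳ-+ ε ½ ½)) (ℚ.*-identityˡ ε)

  0<½* : ∀ {ε} → 0ℚ ℚ.< ε → 0ℚ ℚ.< ½ ℚ.* ε
  0<½* = ℚ.*-monoʳ-<-pos ½

  regroup : ∀ a b c d →
    (a ℚ.+ b) ℚ.- (c ℚ.+ d) ≡ (a ℚ.- c) ℚ.+ (b ℚ.- d)
  regroup = solve 4
    (λ a b c d → (a :+ b) :- (c :+ d) := (a :- c) :+ (b :- d)) refl
    where open +-*-Solver

  +-cauchy : ∀ x y → IsCauchy (λ n → seq x n ℚ.+ seq y n)
  +-cauchy (mkℝ x cx) (mkℝ y cy) ε 0<ε
    with M , p ← cx (½ ℚ.* ε) (0<½* 0<ε)
       | N , q ← cy (½ ℚ.* ε) (0<½* 0<ε) = M ℕ.⊔ N , bound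
    where
    open ℚ.≤-Reasoning
    bound : ∀ m n → M ℕ.⊔ N ℕ.≤ m → M ℕ.⊔ N ℕ.≤ n →
            ℚ.∣ (x m ℚ.+ y m) ℚ.- (x n ℚ.+ y n) ∣ ℚ.< ε
    bound m n ≤m ≤n = begin-strict
      ℚ.∣ (x m ℚ.+ y m) ℚ.- (x n ℚ.+ y n) ∣
        ≡⟨ cong ℚ.∣_∣ (regroup (x m) (y m) (x n) (y n)) ⟩
      ℚ.∣ (x m ℚ.- x n) ℚ.+ (y m ℚ.- y n) ∣
        ≤⟨ ℚ.∣p+q∣≤∣p∣+∣q∣ (x m ℚ.- x n) (y m ℚ.- y n) ⟩
      ℚ.∣ x m ℚ.- x n ∣ ℚ.+ ℚ.∣ y m ℚ.- y n ∣
        <⟨ ℚ.+-mono-<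
             (p m n (ℕ.m⊔n≤o⇒m≤o M N ≤m) (ℕ.m⊔n≤o⇒m≤o M N ≤n))
             (q m n (ℕ.m⊔n≤o⇒n≤o M N ≤m) (ℕ.m⊔n≤o⇒n≤o M N ≤n)) ⟩
      ½ ℚ.* ε ℚ.+ ½ ℚ.* ε
        ≡⟨ halves ε ⟩
      ε ∎

_+_ : ℝ → ℝ → ℝ
x + y = mkℝ (λ n → seq x n ℚ.+ seq y n) (+-cauchy x y)

∑ : ∀ {k} → Subset k → (Fin k → ℝ) → ℝ
∑ []            f = 0ℝ
∑ (inside  ∷ S) f = f zero + ∑ S (λ i → f (suc i))
∑ (outside ∷ S) f = ∑ S (λ i → f (suc i))

------------------------------------------------------------------------
-- Finite simple graphs

-- Vertices are Fin order and edges are Fin size. An undirected edge {u , v}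
-- is recorded once, as the pair with u < v; this excludes loops, and
-- injectivity of ends excludes parallel edges.
record Graph : Set where
  field
    order    : ℕ
    size     : ℕ
    ends     : Fin size → Fin order × Fin order
    ordered  : ∀ e → proj₁ (ends e) Fin.< proj₂ (ends e)
    distinct : Injective _≡_ _≡_ ends

  Vertex Edge VertexSet EdgeSet : Set
  Vertex    = Fin order
  Edge      = Fin size
  VertexSet = Subset order
  EdgeSet   = Subset size

  end₁ end₂ : Edge → Vertex
  end₁ e = proj₁ (ends e)
  end₂ e = proj₂ (ends e)

  Independent : VertexSet → Set
  Independent P = ∀ e → ¬ (end₁ e ∈ P × end₂ e ∈ P)

  E₀ : VertexSet → EdgeSet
  E₀ P = tabulate λ e → not (lookup P (end₁ e)) ∧ not (lookup P (end₂ e))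

  E₁ : VertexSet → EdgeSet
  E₁ P = tabulate λ e → lookup P (end₁ e) xor lookup P (end₂ e)

open Graph using (Vertex; Edge; VertexSet; Independent; E₀; E₁)

------------------------------------------------------------------------
-- Maximization problems over independent sets

record Problem : Set₁ where
  field
    Instance  : Graph → Set
    objective : ∀ G → Instance G → VertexSet G → ℝ

open Problem

Optimal : (A : Problem) (G : Graph) → Instance A G → VertexSet G → Set
Optimal A G I P =
  Independent G P ×
  (∀ Q → Independent G Q → objective A G I Q ≤ objective A G I P)

infix 4 _FormulableAs_ _EquivalentTo_

_FormulableAs_ : Problem → Problem → Set
A FormulableAs B =
  ∀ G (I : Instance A G) →
  ∃ λ (J : Instance B G) → ∀ P → Optimal B G J P → Optimal A G I P

_EquivalentTo_ : Problem → Problem → Set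
A EquivalentTo B = A FormulableAs B × B FormulableAs A

VertexWeights EdgeWeights : Graph → Set
VertexWeights G = Vertex G → ℝ
EdgeWeights   G = Edge G → ℝ

-- Instances are triples (c , q⁰ , q¹).
ISPNEW : Problem
ISPNEW = record
  { Instance  = λ G → VertexWeights G × EdgeWeights G × EdgeWeights G
  ; objective = λ G (c , q⁰ , q¹) P →
      ∑ P c + ∑ (E₀ G P) q⁰ + ∑ (E₁ G P) q¹
  }

ISOP : Problem
ISOP = record
  { Instance  = λ G → VertexWeights G × EdgeWeights G
  ; objective = λ G (c , q⁰) P →
      objective ISPNEW G (c , q⁰ , λ _ → 0ℝ) P
  }

ISUP : Problem
ISUP = record
  { Instance  = λ G → VertexWeights G × EdgeWeights G
  ; objective = λ G (c , q¹) P →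
      objective ISPNEW G (c , (λ _ → 0ℝ) , q¹) P
  }

MWISP : Problem
MWISP = record
  { Instance  = VertexWeights
  ; objective = λ G w P → ∑ P w
  }

{-# OPTIONS --safe #-}
-- Every edge e has at most one endpoint in an independent set P, so e contributes
-- q⁰ e to the objective plus q¹ e − q⁰ e for each of its endpoints that lies in P.
-- Moving these differences to the endpoints gives the vertex weights
-- w i = c i + ∑_{e ∋ i} (q¹ e − q⁰ e), and the two objectives then differ by the
-- constant ∑_e q⁰ e. As addition in ℝ is pointwise, this identity holds exactly,
-- for every term of the sequences.
module Submission where

open import Defs
open import Data.Bool using (Bool; true; false; _∧_; _xor_; not; if_then_else_)
open import Data.Fin using (Fin; zero; suc; _≟_)
open import Data.Fin.Subset using (Subset; inside; outside)
open import Data.Nat using (ℕ)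
open import Data.Product using (_×_; _,_)
open import Data.Rational as ℚ using (ℚ; 0ℚ)
import Data.Rational.Properties as ℚ
open import Data.Rational.Solver using (module +-*-Solver)
open import Data.Vec using ([]; _∷_; lookup; tabulate)
open import Data.Vec.Properties using (lookup∘tabulate; lookup⇒[]=)
open import Relation.Binary.PropositionalEquality
  using (_≡_; refl; sym; trans; cong; cong₂; subst; module ≡-Reasoning)
open import Relation.Nullary using (¬_; does; contradiction)

open Graph using (end₁; end₂; Vertex; Edge; Independent; E₀; E₁)
open Problem

open import Algebra.Properties.CommutativeMonoid.Sum ℚ.+-0-commutativeMonoid
  using (sum; sum-cong-≗; sum-replicate-zero; ∑-distrib-+; ∑-comm)

-- Rational sums weighted by Boolean indicators

infixr 7 _·_

_·_ : Bool → ℚ → ℚ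
b · p = if b then p else 0ℚ

·-zeroʳ : ∀ b → b · 0ℚ ≡ 0ℚ
·-zeroʳ true  = refl
·-zeroʳ false = refl

·-distribˡ-+ : ∀ b p q → b · (p ℚ.+ q) ≡ b · p ℚ.+ b · q
·-distribˡ-+ true  p q = refl
·-distribˡ-+ false p q = refl

·-comm : ∀ a b p → a · b · p ≡ b · a · p
·-comm true  b p = refl
·-comm false b p = sym (·-zeroʳ b)

·-distribˡ-sum : ∀ b {n} (f : Fin n → ℚ) → b · sum f ≡ sum (λ i → b · f i)
·-distribˡ-sum true      f = refl
·-distribˡ-sum false {n} f = sym (sum-replicate-zero n)

sum-δ : ∀ {n} (f : Fin n → ℚ) j → sum (λ i → does (j ≟ i) · f i) ≡ f j
sum-δ {ℕ.suc n} f zero    = trans (cong (f zero ℚ.+_) (sum-replicate-zero n)) (ℚ.+-identityʳ _)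
sum-δ {ℕ.suc n} f (suc j) = trans (ℚ.+-identityˡ _) (sum-δ (λ i → f (suc i)) j)

-- Double counting: after interchanging the sums, each `e` meets exactly one `i`, namely `h e`, and
-- `sum-δ` picks out that term. With `h` an endpoint map, this turns weights gathered at vertices
-- back into a sum over edges.
sum-fibres : ∀ {m n} (χ : Fin n → Bool) (h : Fin m → Fin n) (f : Fin m → ℚ) →
  sum (λ i → χ i · sum (λ e → does (h e ≟ i) · f e)) ≡ sum (λ e → χ (h e) · f e)
sum-fibres χ h f = begin
  sum (λ i → χ i · sum (λ e → does (h e ≟ i) · f e))
    ≡⟨ sum-cong-≗ (λ i → ·-distribˡ-sum (χ i) (λ e → does (h e ≟ i) · f e)) ⟩
  sum (λ i → sum (λ e → χ i · does (h e ≟ i) · f e))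
    ≡⟨ ∑-comm (λ i e → χ i · does (h e ≟ i) · f e) ⟩
  sum (λ e → sum (λ i → χ i · does (h e ≟ i) · f e))
    ≡⟨ sum-cong-≗ (λ e → sum-cong-≗ (λ i → ·-comm (χ i) (does (h e ≟ i)) (f e))) ⟩
  sum (λ e → sum (λ i → does (h e ≟ i) · χ i · f e))
    ≡⟨ sum-cong-≗ (λ e → sum-δ (λ i → χ i · f e) (h e)) ⟩
  sum (λ e → χ (h e) · f e) ∎
  where open ≡-Reasoning

-- Termwise reasoning about reals and optima

-_ : ℝ → ℝ
- x = mkℝ (λ n → ℚ.- seq x n) λ ε 0<ε →
  let N , close = cauchy x ε 0<ε in
  N , λ m n N≤m N≤n → subst (ℚ._< ε) (negated (seq x m) (seq x n)) (close m n N≤m N≤n)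
  where
  negated : ∀ p q → ℚ.∣ p ℚ.- q ∣ ≡ ℚ.∣ ℚ.- p ℚ.- ℚ.- q ∣
  negated p q = trans (sym (ℚ.∣-p∣≡∣p∣ (p ℚ.- q))) (cong ℚ.∣_∣ (ℚ.neg-distrib-+ p (ℚ.- q)))

-- At each index both sides move by the same rational `k n`, so the threshold `N` that works for
-- `x ≤ y` works for `x′ ≤ y′` as well.
≤-translate : ∀ {x y x′ y′} (k : ℕ → ℚ) →
  (∀ n → seq x′ n ≡ seq x n ℚ.+ k n) → (∀ n → seq y′ n ≡ seq y n ℚ.+ k n) →
  x ≤ y → x′ ≤ y′
≤-translate {x} {y} {x′} {y′} k x′≡ y′≡ x≤y ε 0<ε =
  let N , below = x≤y ε 0<ε in N , λ n N≤n → begin-strict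
    seq x′ n                   ≡⟨ x′≡ n ⟩
    seq x n ℚ.+ k n            <⟨ ℚ.+-monoˡ-< (k n) (below n N≤n) ⟩
    (seq y n ℚ.+ ε) ℚ.+ k n    ≡⟨ swap (seq y n) ε (k n) ⟩
    (seq y n ℚ.+ k n) ℚ.+ ε    ≡⟨ cong (ℚ._+ ε) (y′≡ n) ⟨
    seq y′ n ℚ.+ ε             ∎
  where
  open ℚ.≤-Reasoning
  swap : ∀ p q r → (p ℚ.+ q) ℚ.+ r ≡ (p ℚ.+ r) ℚ.+ q
  swap = solve 3 (λ p q r → (p :+ q) :+ r := (p :+ r) :+ q) refl
    where open +-*-Solver

-- Replaces a sum over a subset by a sum over all indices with an indicator, a form in which sums
-- can be split and interchanged.
seq-∑ : ∀ {k} (S : Subset k) f n → seq (∑ S f) n ≡ sum (λ i → lookup S i · seq (f i) n)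
seq-∑ []            f n = refl
seq-∑ (inside  ∷ S) f n = cong (seq (f zero) n ℚ.+_) (seq-∑ S (λ i → f (suc i)) n)
seq-∑ (outside ∷ S) f n =
  trans (seq-∑ S (λ i → f (suc i)) n) (sym (ℚ.+-identityˡ _))

seq-∑-tabulate : ∀ {k} (χ : Fin k → Bool) f n →
  seq (∑ (tabulate χ) f) n ≡ sum (λ i → χ i · seq (f i) n)
seq-∑-tabulate χ f n = trans (seq-∑ (tabulate χ) f n)
  (sum-cong-≗ (λ i → cong (_· seq (f i) n) (lookup∘tabulate χ i)))

seq-∑-0ℝ : ∀ {k} (S : Subset k) n → seq (∑ S (λ _ → 0ℝ)) n ≡ 0ℚ
seq-∑-0ℝ []            n = refl
seq-∑-0ℝ (inside  ∷ S) n = trans (ℚ.+-identityˡ _) (seq-∑-0ℝ S n)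
seq-∑-0ℝ (outside ∷ S) n = seq-∑-0ℝ S n

-- Both problems have the same feasible sets, and `k` is fixed before `P`, so every comparison
-- between independent sets is shifted equally on both sides.
Optimal-translate : ∀ A B G {I : Instance A G} {J : Instance B G} (k : ℕ → ℚ) →
  (∀ P → Independent G P → ∀ n →
    seq (objective A G I P) n ≡ seq (objective B G J P) n ℚ.+ k n) →
  ∀ P → Optimal B G J P → Optimal A G I P
Optimal-translate A B G {I} {J} k shifted P (indP , maxP) = indP , λ Q indQ →
  ≤-translate {objective B G J Q} {objective B G J P} {objective A G I Q} {objective A G I P}
    k (shifted Q indQ) (shifted P indP) (maxP Q indQ)

-- Here `a` and `b` tell which ends of an edge are chosen. With both chosen the left side would be 0
-- but the right side `2q − p`; this is the case that independence rules out.
edge-contribution : ∀ a b p q → ¬ (a ≡ true × b ≡ true) →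
  (not a ∧ not b) · p ℚ.+ (a xor b) · q ≡
  (a · (q ℚ.- p) ℚ.+ b · (q ℚ.- p)) ℚ.+ p
edge-contribution true  true  p q ¬both = contradiction (refl , refl) ¬both
edge-contribution true  false p q _ =
  -- A false indicator reduces its term to the literal `0ℚ`, hence `con 0ℚ`.
  solve 2 (λ p q → con 0ℚ :+ q := ((q :- p) :+ con 0ℚ) :+ p) refl p q
  where open +-*-Solver
edge-contribution false true  p q _ =
  solve 2 (λ p q → con 0ℚ :+ q := (con 0ℚ :+ (q :- p)) :+ p) refl p q
  where open +-*-Solver
edge-contribution false false p q _ =
  solve 1 (λ p → p :+ con 0ℚ := (con 0ℚ :+ con 0ℚ) :+ p) refl p
  where open +-*-Solver

-- Reduction of ISPNEW to MWISP

module _ (G : Graph) (c : VertexWeights G) (q⁰ q¹ : EdgeWeights G) where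

  gain : EdgeWeights G
  gain e = q¹ e + - q⁰ e

  -- An edge is stored as an ordered pair, so the edges at `i` are collected separately by first and
  -- second end. As the first end is strictly smaller, no edge occurs in both sums.
  weight : VertexWeights G
  weight i = c i + ∑ (tabulate λ e → does (end₁ G e ≟ i)) gain
                 + ∑ (tabulate λ e → does (end₂ G e ≟ i)) gain

  seq-∑-weight : ∀ P n →
    seq (∑ P weight) n ≡
    sum (λ i → lookup P i · seq (c i) n) ℚ.+
    sum (λ e → lookup P (end₁ G e) · seq (gain e) n) ℚ.+
    sum (λ e → lookup P (end₂ G e) · seq (gain e) n)
  seq-∑-weight P n = begin
    seq (∑ P weight) n
      ≡⟨ seq-∑ P weight n ⟩
    sum (λ i → χ i · seq (weight i) n)
      ≡⟨ sum-cong-≗ split ⟩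
    sum (λ i → (χ i · seq (c i) n ℚ.+ χ i · fibre (end₁ G) i) ℚ.+ χ i · fibre (end₂ G) i)
      ≡⟨ ∑-distrib-+ (λ i → χ i · seq (c i) n ℚ.+ χ i · fibre (end₁ G) i) _ ⟩
    sum (λ i → χ i · seq (c i) n ℚ.+ χ i · fibre (end₁ G) i) ℚ.+
    sum (λ i → χ i · fibre (end₂ G) i)
      ≡⟨ cong (ℚ._+ sum (λ i → χ i · fibre (end₂ G) i)) (∑-distrib-+ (λ i → χ i · seq (c i) n) _) ⟩
    sum (λ i → χ i · seq (c i) n) ℚ.+ sum (λ i → χ i · fibre (end₁ G) i) ℚ.+
    sum (λ i → χ i · fibre (end₂ G) i)
      ≡⟨ cong₂ (λ s t → sum (λ i → χ i · seq (c i) n) ℚ.+ s ℚ.+ t)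
           (sum-fibres χ (end₁ G) gainₙ) (sum-fibres χ (end₂ G) gainₙ) ⟩
    sum (λ i → χ i · seq (c i) n) ℚ.+
    sum (λ e → χ (end₁ G e) · gainₙ e) ℚ.+
    sum (λ e → χ (end₂ G e) · gainₙ e) ∎
    where
    open ≡-Reasoning
    χ : Vertex G → Bool
    χ = lookup P
    gainₙ : Edge G → ℚ
    gainₙ e = seq (gain e) n
    fibre : (Edge G → Vertex G) → Vertex G → ℚ
    fibre end i = sum (λ e → does (end e ≟ i) · gainₙ e)
    split : ∀ i → χ i · seq (weight i) n ≡
      (χ i · seq (c i) n ℚ.+ χ i · fibre (end₁ G) i) ℚ.+ χ i · fibre (end₂ G) i
    split i = begin
      χ i · seq (weight i) n
        ≡⟨ cong₂ (λ s t → χ i · ((seq (c i) n ℚ.+ s) ℚ.+ t))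
             (seq-∑-tabulate (λ e → does (end₁ G e ≟ i)) gain n)
             (seq-∑-tabulate (λ e → does (end₂ G e ≟ i)) gain n) ⟩
      χ i · ((seq (c i) n ℚ.+ fibre (end₁ G) i) ℚ.+ fibre (end₂ G) i)
        ≡⟨ ·-distribˡ-+ (χ i) (seq (c i) n ℚ.+ fibre (end₁ G) i) _ ⟩
      χ i · (seq (c i) n ℚ.+ fibre (end₁ G) i) ℚ.+ χ i · fibre (end₂ G) i
        ≡⟨ cong (ℚ._+ χ i · fibre (end₂ G) i) (·-distribˡ-+ (χ i) (seq (c i) n) _) ⟩
      (χ i · seq (c i) n ℚ.+ χ i · fibre (end₁ G) i) ℚ.+ χ i · fibre (end₂ G) i ∎

  edge-sums : ∀ P → Independent G P → ∀ n →
    seq (∑ (E₀ G P) q⁰) n ℚ.+ seq (∑ (E₁ G P) q¹) n ≡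
    (sum (λ e → lookup P (end₁ G e) · seq (gain e) n) ℚ.+
     sum (λ e → lookup P (end₂ G e) · seq (gain e) n)) ℚ.+
    sum (λ e → seq (q⁰ e) n)
  edge-sums P indP n = begin
    seq (∑ (E₀ G P) q⁰) n ℚ.+ seq (∑ (E₁ G P) q¹) n
      ≡⟨ cong₂ ℚ._+_ (seq-∑-tabulate (λ e → not (u e) ∧ not (v e)) q⁰ n)
                     (seq-∑-tabulate (λ e → u e xor v e) q¹ n) ⟩
    sum (λ e → (not (u e) ∧ not (v e)) · seq (q⁰ e) n) ℚ.+
    sum (λ e → (u e xor v e) · seq (q¹ e) n)
      ≡⟨ ∑-distrib-+ (λ e → (not (u e) ∧ not (v e)) · seq (q⁰ e) n) _ ⟨
    sum (λ e → (not (u e) ∧ not (v e)) · seq (q⁰ e) n ℚ.+ (u e xor v e) · seq (q¹ e) n)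
      -- Independence of `P` enters here: two true lookups would put both ends of `e` in `P`.
      ≡⟨ sum-cong-≗ (λ e → edge-contribution (u e) (v e) (seq (q⁰ e) n) (seq (q¹ e) n)
           λ (ue , ve) → indP e (lookup⇒[]= (end₁ G e) P ue , lookup⇒[]= (end₂ G e) P ve)) ⟩
    sum (λ e → (u e · gainₙ e ℚ.+ v e · gainₙ e) ℚ.+ seq (q⁰ e) n)
      ≡⟨ ∑-distrib-+ (λ e → u e · gainₙ e ℚ.+ v e · gainₙ e) _ ⟩
    sum (λ e → u e · gainₙ e ℚ.+ v e · gainₙ e) ℚ.+ sum (λ e → seq (q⁰ e) n)
      ≡⟨ cong (ℚ._+ sum (λ e → seq (q⁰ e) n)) (∑-distrib-+ (λ e → u e · gainₙ e) _) ⟩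
    (sum (λ e → u e · gainₙ e) ℚ.+ sum (λ e → v e · gainₙ e)) ℚ.+
    sum (λ e → seq (q⁰ e) n) ∎
    where
    open ≡-Reasoning
    u v : Edge G → Bool
    u e = lookup P (end₁ G e)
    v e = lookup P (end₂ G e)
    gainₙ : Edge G → ℚ
    gainₙ e = seq (gain e) n

  objective-translate : ∀ P → Independent G P → ∀ n →
    seq (objective ISPNEW G (c , q⁰ , q¹) P) n ≡
    seq (∑ P weight) n ℚ.+ sum (λ e → seq (q⁰ e) n)
  objective-translate P indP n = begin
    seq (∑ P c) n ℚ.+ seq (∑ (E₀ G P) q⁰) n ℚ.+ seq (∑ (E₁ G P) q¹) n
      ≡⟨ ℚ.+-assoc (seq (∑ P c) n) _ _ ⟩
    seq (∑ P c) n ℚ.+ (seq (∑ (E₀ G P) q⁰) n ℚ.+ seq (∑ (E₁ G P) q¹) n)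
      ≡⟨ cong₂ ℚ._+_ (seq-∑ P c n) (edge-sums P indP n) ⟩
    cₙ ℚ.+ ((gain₁ ℚ.+ gain₂) ℚ.+ k)
      ≡⟨ ℚ.+-assoc cₙ _ _ ⟨
    (cₙ ℚ.+ (gain₁ ℚ.+ gain₂)) ℚ.+ k
      ≡⟨ cong (ℚ._+ k) (ℚ.+-assoc cₙ _ _) ⟨
    (cₙ ℚ.+ gain₁ ℚ.+ gain₂) ℚ.+ k
      ≡⟨ cong (ℚ._+ k) (seq-∑-weight P n) ⟨
    seq (∑ P weight) n ℚ.+ k ∎
    where
    open ≡-Reasoning
    cₙ gain₁ gain₂ k : ℚ
    cₙ    = sum (λ i → lookup P i · seq (c i) n)
    gain₁ = sum (λ e → lookup P (end₁ G e) · seq (gain e) n)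
    gain₂ = sum (λ e → lookup P (end₂ G e) · seq (gain e) n)
    k     = sum (λ e → seq (q⁰ e) n)

-- Embedding of MWISP and the two special cases

objective-no-edge-weights : ∀ G w P n →
  seq (∑ P w) n ≡
  seq (objective ISPNEW G (w , (λ _ → 0ℝ) , λ _ → 0ℝ) P) n ℚ.+ 0ℚ
objective-no-edge-weights G w P n = sym (begin
  seq (∑ P w) n ℚ.+ seq (∑ (E₀ G P) λ _ → 0ℝ) n ℚ.+ seq (∑ (E₁ G P) λ _ → 0ℝ) n ℚ.+ 0ℚ
    ≡⟨ ℚ.+-identityʳ _ ⟩
  seq (∑ P w) n ℚ.+ seq (∑ (E₀ G P) λ _ → 0ℝ) n ℚ.+ seq (∑ (E₁ G P) λ _ → 0ℝ) n
    ≡⟨ cong₂ (λ s t → seq (∑ P w) n ℚ.+ s ℚ.+ t)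
         (seq-∑-0ℝ (E₀ G P) n) (seq-∑-0ℝ (E₁ G P) n) ⟩
  seq (∑ P w) n ℚ.+ 0ℚ ℚ.+ 0ℚ
    ≡⟨ ℚ.+-identityʳ _ ⟩
  seq (∑ P w) n ℚ.+ 0ℚ
    ≡⟨ ℚ.+-identityʳ _ ⟩
  seq (∑ P w) n ∎)
  where open ≡-Reasoning

ISPNEW⇒MWISP : ISPNEW FormulableAs MWISP
ISPNEW⇒MWISP G (c , q⁰ , q¹) = weight G c q⁰ q¹ ,
  Optimal-translate ISPNEW MWISP G (λ n → sum (λ e → seq (q⁰ e) n))
    (objective-translate G c q⁰ q¹)

-- Serves all three problems: with zero edge weights, the objectives of `ISOP` and `ISUP` unfold to
-- this same `ISPNEW` objective.
MWISP-Optimal : ∀ G w P →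
  Optimal ISPNEW G (w , (λ _ → 0ℝ) , λ _ → 0ℝ) P → Optimal MWISP G w P
MWISP-Optimal G w = Optimal-translate MWISP ISPNEW G (λ _ → 0ℚ)
  (λ P _ → objective-no-edge-weights G w P)

theorem9 : (ISPNEW EquivalentTo MWISP) × (ISOP EquivalentTo MWISP) × (ISUP EquivalentTo MWISP)
theorem9 =
  (ISPNEW⇒MWISP ,
   λ G w → (w , (λ _ → 0ℝ) , λ _ → 0ℝ) , MWISP-Optimal G w) ,
  -- The objective of `ISOP` is by definition that of `ISPNEW` with `q¹` zero, so the general
  -- reduction applies unchanged; likewise for `ISUP` with `q⁰` zero.
  ((λ G (c , q⁰) → ISPNEW⇒MWISP G (c , q⁰ , λ _ → 0ℝ)) ,
   λ G w → (w , λ _ → 0ℝ) , MWISP-Optimal G w) ,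
  ((λ G (c , q¹) → ISPNEW⇒MWISP G (c , (λ _ → 0ℝ) , q¹)) ,
   λ G w → (w , λ _ → 0ℝ) , MWISP-Optimal G w)
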